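{- For every integer $d\ge 1$, $\gamma_1^{\mathrm L}(Q_d)=2^{d-1}$.
   Context: All graphs are finite and simple; $N_G(u)$ is the open neighborhood of $u$ in $G$. A set $D\subseteq V(G)$ is a dominating set if every vertex of $V(G)\setminus D$ has a neighbor in $D$. A dominating set $D$ of $G$ is a $1$-limited dominating set if $|N_G(u)\setminus D|\le 1$ for every $u\in D$. The $1$-limited domination number $\gamma_1^{\mathrm L}(G)$ is the minimum cardinality of a $1$-limited dominating set of $G$. The hypercube $Q_d$ has vertex set $\{0,1\}^d$, two vertices being adjacent if and only if they differ in exactly one coordinate. -}

module Defs where

open import Data.Bool using (Bool)
import Data.Bool.Properties as Bool
open import Data.Fin using (Fin)
open import Data.Fin.Properties using (_≟_; any?; all?; *↔×; 2↔Bool)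
open import Data.Fin.Subset as Subset using (Subset; ∣_∣; _─_; ⊤)
open import Data.Fin.Subset.Properties as Subset
  using (anySubset?; ∈⊤; p─⊤≡⊥; ∣⊥∣≡0)
open import Data.Nat using (ℕ; zero; suc; _^_; _≤_; z≤n; _≤?_)
import Data.Nat as ℕ
open import Data.Nat.Induction using (<-rec)
open import Data.Nat.Properties using (≮⇒≥; anyUpTo?)
open import Data.Product using (_×_; _,_; proj₁; ∃; ∃-syntax; ∃!; uncurry)
open import Data.Product.Function.NonDependent.Propositional using (_×-↔_)
open import Data.Vec using (Vec; []; _∷_; head; tail; lookup; tabulate)
open import Function using (_∘_; _↔_; mk↔ₛ′; Inverse)
open import Function.Construct.Composition using (_↔-∘_)
open import Relation.Binary using (Rel; Symmetric; Irreflexive)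
import Relation.Binary as Binary
open import Relation.Binary.PropositionalEquality
  using (_≡_; _≢_; refl; sym; subst)
open import Relation.Nullary using (¬_; Dec; yes; no; does; ¬?; contradiction)
open import Relation.Nullary.Decidable using (_×-dec_; _→-dec_; map′)
open import Relation.Unary using (Pred; Decidable)
open import Level using (0ℓ)

------------------------------------------------------------------------
-- Minima of sets of natural numbers

IsMinimum : Pred ℕ 0ℓ → ℕ → Set
IsMinimum P m = P m × (∀ n → P n → m ≤ n)

minimum : {P : Pred ℕ 0ℓ} → Decidable P → ∃ P → ∃ (IsMinimum P)
minimum {P} P? (n , Pn) = <-rec (λ n → P n → ∃ (IsMinimum P)) step n Pn
  where
  step : ∀ n → (∀ {m} → m ℕ.< n → P m → ∃ (IsMinimum P)) → P n → ∃ (IsMinimum P)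
  step n rec Pn with anyUpTo? P? n
  ... | yes (m , m<n , Pm) = rec m<n Pm
  ... | no  none           = n , Pn , λ m Pm → ≮⇒≥ (λ m<n → none (m , m<n , Pm))

------------------------------------------------------------------------
-- Finite simple graphs

record Graph : Set₁ where
  infix 4 _~_ _~?_
  field
    Vertex   : Set
    order    : ℕ
    enum     : Fin order ↔ Vertex
    _~_      : Rel Vertex 0ℓ
    _~?_     : Binary.Decidable _~_
    ~-sym    : Symmetric _~_
    ~-irrefl : Irreflexive _≡_ _~_

  vertex : Fin order → Vertex
  vertex = Inverse.to enum

  index : Vertex → Fin order
  index = Inverse.from enum

module _ (G : Graph) where
  open Graph G

  -- A set of vertices is represented by the set of their indices under
  -- `enum`, so that cardinality and difference are those of
  -- Data.Fin.Subset.
  VertexSet : Set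
  VertexSet = Subset order

  infix 4 _∈_ _∉_ _∈?_

  _∈_ : Vertex → VertexSet → Set
  v ∈ D = index v Subset.∈ D

  _∉_ : Vertex → VertexSet → Set
  v ∉ D = ¬ (v ∈ D)

  _∈?_ : Binary.Decidable _∈_
  v ∈? D = index v Subset.∈? D

  N : Vertex → VertexSet
  N u = tabulate (λ i → does (u ~? vertex i))

  IsDominating : VertexSet → Set
  IsDominating D = ∀ v → v ∉ D → ∃[ u ] (v ~ u × u ∈ D)

  Is1LimitedDominating : VertexSet → Set
  Is1LimitedDominating D =
    IsDominating D × (∀ u → u ∈ D → ∣ N u ─ D ∣ ≤ 1)

  1LimitedDominatingCardinality : Pred ℕ 0ℓ
  1LimitedDominatingCardinality k =
    ∃[ D ] (Is1LimitedDominating D × ∣ D ∣ ≡ k)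

  private
    all-vertices? : {P : Pred Vertex 0ℓ} → Decidable P → Dec (∀ v → P v)
    all-vertices? {P} P? =
      map′ (λ h v → subst P (Inverse.strictlyInverseˡ enum v) (h (index v)))
           (_∘ vertex)
           (all? (P? ∘ vertex))

    any-vertex? : {P : Pred Vertex 0ℓ} → Decidable P → Dec (∃ P)
    any-vertex? {P} P? =
      map′ (λ (i , p) → vertex i , p)
           (λ (v , p) → index v , subst P (sym (Inverse.strictlyInverseˡ enum v)) p)
           (any? (P? ∘ vertex))

  is1LimitedDominating? : Decidable Is1LimitedDominating
  is1LimitedDominating? D =
    all-vertices? (λ v → ¬? (v ∈? D) →-dec
                         any-vertex? (λ u → (v ~? u) ×-dec (u ∈? D)))
    ×-dec
    all-vertices? (λ u → (u ∈? D) →-dec (∣ N u ─ D ∣ ≤? 1))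

  ⊤-is1LimitedDominating : Is1LimitedDominating ⊤
  ⊤-is1LimitedDominating =
    (λ v v∉⊤ → contradiction ∈⊤ v∉⊤) ,
    (λ u _ → subst (_≤ 1) (sym (∣N─⊤∣≡0 u)) z≤n)
    where
    ∣N─⊤∣≡0 : ∀ u → ∣ N u ─ ⊤ ∣ ≡ 0
    ∣N─⊤∣≡0 u rewrite p─⊤≡⊥ (N u) = ∣⊥∣≡0 order

  γ₁ᴸ-minimum : ∃ (IsMinimum 1LimitedDominatingCardinality)
  γ₁ᴸ-minimum =
    minimum
      (λ k → anySubset? (λ D → is1LimitedDominating? D ×-dec (∣ D ∣ ℕ.≟ k)))
      (∣ ⊤ {order} ∣ , ⊤ , ⊤-is1LimitedDominating , refl)

  γ₁ᴸ : ℕ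
  γ₁ᴸ = proj₁ γ₁ᴸ-minimum

------------------------------------------------------------------------
-- Hypercubes

DifferInExactlyOne : ∀ {d} → Rel (Vec Bool d) 0ℓ
DifferInExactlyOne u v = ∃! _≡_ (λ i → lookup u i ≢ lookup v i)

differInExactlyOne? : ∀ {d} → Binary.Decidable (DifferInExactlyOne {d})
differInExactlyOne? u v = any? λ i →
  differ? i ×-dec
  map′ (λ h {j} → h j) (λ h j → h {j}) (all? λ j → differ? j →-dec (i ≟ j))
  where
  differ? : ∀ i → Dec (lookup u i ≢ lookup v i)
  differ? i = ¬? (lookup u i Bool.≟ lookup v i)

bits : ∀ d → Fin (2 ^ d) ↔ Vec Bool d
bits zero    = mk↔ₛ′ (λ _ → []) (λ _ → Fin.zero)
                     (λ { [] → refl }) (λ { Fin.zero → refl ; (Fin.suc ()) })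
bits (suc d) = cons ↔-∘ ((2↔Bool ×-↔ bits d) ↔-∘ *↔× {2} {2 ^ d})
  where
  cons : (Bool × Vec Bool d) ↔ Vec Bool (suc d)
  cons = mk↔ₛ′ (uncurry _∷_) (λ v → head v , tail v)
               (λ { (_ ∷ _) → refl }) (λ _ → refl)

Q : ℕ → Graph
Q d = record
  { Vertex   = Vec Bool d
  ; order    = 2 ^ d
  ; enum     = bits d
  ; _~_      = DifferInExactlyOne
  ; _~?_     = differInExactlyOne?
  ; ~-sym    = λ (i , ui≢vi , unique) →
                 i , ui≢vi ∘ sym , λ vj≢uj → unique (vj≢uj ∘ sym)
  ; ~-irrefl = λ { refl (_ , ui≢ui , _) → ui≢ui refl }
  }

{-# OPTIONS --safe #-}
-- In a 1-limited dominating set D each member dominates at most one vertex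
-- outside D, so choosing dominators injects the complement of D into D and
-- the order is at most 2∣D∣. In a hypercube of positive dimension, a facet
-- (the vertices with first coordinate true) attains this bound: the first
-- coordinate pairs its members with the vertices outside it.
module Submission where

open import Defs
open import Data.Bool using (Bool; true; false)
import Data.Bool.Properties as Bool
open import Data.Fin using (Fin; zero; suc)
open import Data.Fin.Properties using (_≟_; suc-injective)
open import Data.Fin.Subset as Subset
  using (Subset; inside; outside; ∣_∣; _─_; _-_; ⊤; ∁)
open import Data.Fin.Subset.Properties
  using (∈⊤; ∣⊤∣≡n; ∣∁p∣≡n∸∣p∣; x∈∁p⇒x∉p; p─q⊆p; x∈p∧x∉q⇒x∈p─q;
         x∈p∧x≢y⇒x∈p-y; x∈p⇒∣p-x∣<∣p∣)
open import Data.Nat using (ℕ; suc; _≤_; _^_; _∸_; _*_; _+_; z≤n; s≤s)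
open import Data.Nat.Properties as ℕ using (module ≤-Reasoning)
open import Data.Product using (_×_; _,_; ∃-syntax)
open import Data.Unit using (tt)
import Data.Unit as Unit
open import Data.Vec using (Vec; []; _∷_; here; there; head; tail; lookup; tabulate)
open import Data.Vec.Properties
  using ([]=⇒lookup; lookup⇒[]=; lookup∘tabulate; tabulate∘lookup; tabulate-cong)
open import Function using (_∘_; Inverse)
open import Relation.Binary.PropositionalEquality
  using (_≡_; _≢_; _≗_; refl; sym; trans; cong; cong₂; subst)
open import Relation.Nullary using (¬_; yes; no; does; contradiction)
open import Relation.Nullary.Decidable using (dec-true; decidable-stable)

private variable
  m n d : ℕ

-- Pigeonhole by induction on `p`: the partner `j` of the first member is deleted from `q`, and no
-- later member has lost its partner, since sharing `j` would force `zero ≡ suc i`. A relation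
-- replaces a function because a partner is available only for members of `p`.
∣∣-mono-injective : (R : Fin m → Fin n → Set) (p : Subset m) (q : Subset n) →
  (∀ {i} → i Subset.∈ p → ∃[ j ] (j Subset.∈ q × R i j)) →
  (∀ {i i′ j} → i Subset.∈ p → i′ Subset.∈ p → R i j → R i′ j → i ≡ i′) →
  ∣ p ∣ ≤ ∣ q ∣
∣∣-mono-injective R []            q total inj = z≤n
∣∣-mono-injective R (outside ∷ p) q total inj =
  ∣∣-mono-injective (R ∘ suc) p q (total ∘ there)
    λ i∈p i′∈p r r′ → suc-injective (inj (there i∈p) (there i′∈p) r r′)
∣∣-mono-injective R (inside ∷ p) q total inj with total here
... | j , j∈q , r₀ = ℕ.≤-trans (s≤s rest) (x∈p⇒∣p-x∣<∣p∣ j∈q)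
  where
  total′ : ∀ {i} → i Subset.∈ p → ∃[ k ] (k Subset.∈ q - j × R (suc i) k)
  total′ {i} i∈p with total (there i∈p)
  ... | k , k∈q , r = k , x∈p∧x≢y⇒x∈p-y k∈q k≢j , r
    where
    k≢j : k ≢ j
    k≢j refl with inj here (there i∈p) r₀ r
    ... | ()

  rest : ∣ p ∣ ≤ ∣ q - j ∣
  rest = ∣∣-mono-injective (R ∘ suc) p (q - j) total′
    λ i∈p i′∈p r r′ → suc-injective (inj (there i∈p) (there i′∈p) r r′)

∣p∣≤1⇒unique : {p : Subset n} → ∣ p ∣ ≤ 1 →
  ∀ {i j} → i Subset.∈ p → j Subset.∈ p → i ≡ j
∣p∣≤1⇒unique {p = p} ∣p∣≤1 {i} {j} i∈p j∈p with i ≟ j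
... | yes i≡j = i≡j
... | no  i≢j = contradiction 2≤1 λ { (s≤s ()) }
  where
  open ≤-Reasoning
  2≤1 : 2 ≤ 1
  2≤1 = begin
    2                 ≤⟨ s≤s (ℕ.≤-trans (s≤s z≤n) (x∈p⇒∣p-x∣<∣p∣ (x∈p∧x≢y⇒x∈p-y i∈p i≢j))) ⟩
    suc ∣ p - j ∣     ≤⟨ x∈p⇒∣p-x∣<∣p∣ j∈p ⟩
    ∣ p ∣             ≤⟨ ∣p∣≤1 ⟩
    1                 ∎

unique⇒∣p∣≤1 : (p : Subset n) →
  (∀ {i j} → i Subset.∈ p → j Subset.∈ p → i ≡ j) → ∣ p ∣ ≤ 1
unique⇒∣p∣≤1 p unique =
  -- Against a one-element target with the always-true relation, injectivity is exactly uniqueness.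
  ∣∣-mono-injective (λ _ _ → Unit.⊤) p (⊤ {1})
    (λ _ → zero , here , tt) (λ i∈p j∈p _ _ → unique i∈p j∈p)

x∈p─q⇒x∉q : (p q : Subset n) → ∀ {x} → x Subset.∈ p ─ q → ¬ (x Subset.∈ q)
x∈p─q⇒x∉q (_ ∷ p) (inside  ∷ q) (there x∈) (there x∈q) = x∈p─q⇒x∉q p q x∈ x∈q
x∈p─q⇒x∉q (_ ∷ p) (outside ∷ q) (there x∈) (there x∈q) = x∈p─q⇒x∉q p q x∈ x∈q

∈-tabulate⁺ : (f : Fin n → Bool) → ∀ {i} → f i ≡ true → i Subset.∈ tabulate f
∈-tabulate⁺ f {i} fi = lookup⇒[]= i _ (trans (lookup∘tabulate f i) fi)

∈-tabulate⁻ : (f : Fin n → Bool) → ∀ {i} → i Subset.∈ tabulate f → f i ≡ true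
∈-tabulate⁻ f {i} i∈ = trans (sym (lookup∘tabulate f i)) ([]=⇒lookup i∈)

module _ (G : Graph) where
  open Graph G

  vertex-index : ∀ v → vertex (index v) ≡ v
  vertex-index = Inverse.strictlyInverseˡ enum

  index-vertex : ∀ i → index (vertex i) ≡ i
  index-vertex = Inverse.strictlyInverseʳ enum

  ∈-N⁺ : ∀ u {i} → u ~ vertex i → i Subset.∈ N G u
  ∈-N⁺ u {i} u~i = ∈-tabulate⁺ _ (dec-true (u ~? vertex i) u~i)

  ∈-N⁻ : ∀ u {i} → i Subset.∈ N G u → u ~ vertex i
  ∈-N⁻ u {i} i∈N with u ~? vertex i | ∈-tabulate⁻ (λ j → does (u ~? vertex j)) i∈N
  ... | yes u~i | _ = u~i

  order≤∣D∣+∣D∣ : ∀ D → Is1LimitedDominating G D → order ≤ ∣ D ∣ + ∣ D ∣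
  order≤∣D∣+∣D∣ D (dominating , limited) =
    ℕ.≤-trans (ℕ.m≤n+m∸n order ∣ D ∣)
      (ℕ.+-monoʳ-≤ ∣ D ∣ (subst (_≤ ∣ D ∣) (∣∁p∣≡n∸∣p∣ D) ∣∁D∣≤∣D∣))
    where
    -- Membership of `j` is part of the relation because the injectivity argument of
    -- `∣∣-mono-injective` receives no proof that `j` lies in the target.
    Dominates : Fin order → Fin order → Set
    Dominates i j = vertex j ~ vertex i × j Subset.∈ D

    total : ∀ {i} → i Subset.∈ ∁ D → ∃[ j ] (j Subset.∈ D × Dominates i j)
    total {i} i∈∁D
      with dominating (vertex i) (x∈∁p⇒x∉p i∈∁D ∘ subst (Subset._∈ D) (index-vertex i))
    ... | u , i~u , u∈D =
      index u , u∈D , subst (_~ vertex i) (sym (vertex-index u)) (~-sym i~u) , u∈D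

    ∈N─D : ∀ {i j} → i Subset.∈ ∁ D → vertex j ~ vertex i →
           i Subset.∈ N G (vertex j) ─ D
    ∈N─D {j = j} i∈∁D j~i = x∈p∧x∉q⇒x∈p─q (∈-N⁺ (vertex j) j~i) (x∈∁p⇒x∉p i∈∁D)

    ∣∁D∣≤∣D∣ : ∣ ∁ D ∣ ≤ ∣ D ∣
    ∣∁D∣≤∣D∣ = ∣∣-mono-injective Dominates (∁ D) D total
      -- Two vertices outside `D` dominated by the same `j` both lie in `N G (vertex j) ─ D`, which
      -- has at most one element.
      λ { {j = j} i∈∁D i′∈∁D (j~i , j∈D) (j~i′ , _) →
          ∣p∣≤1⇒unique
            (limited (vertex j) (subst (Subset._∈ D) (sym (index-vertex j)) j∈D))
            (∈N─D i∈∁D j~i) (∈N─D i′∈∁D j~i′) }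

lookup-injective : {A : Set} {xs ys : Vec A n} → lookup xs ≗ lookup ys → xs ≡ ys
lookup-injective {xs = xs} {ys} eq =
  trans (sym (tabulate∘lookup xs)) (trans (tabulate-cong eq) (tabulate∘lookup ys))

-- The single differing coordinate is already `zero`; a difference at `suc i` would be a second one.
heads-differ⇒tails≡ : (u v : Vec Bool (suc d)) → head u ≢ head v →
  DifferInExactlyOne u v → tail u ≡ tail v
heads-differ⇒tails≡ (x ∷ xs) (y ∷ ys) x≢y (_ , _ , unique) =
  lookup-injective λ i → decidable-stable (lookup xs i Bool.≟ lookup ys i)
    λ xi≢yi → contradiction (trans (sym (unique {zero} x≢y)) (unique {suc i} xi≢yi)) λ ()

heads-differ : ∀ {x y} (v : Vec Bool d) → x ≢ y → DifferInExactlyOne (x ∷ v) (y ∷ v)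
heads-differ v x≢y = zero , x≢y , λ
  { {zero}  _     → refl
  ; {suc i} vi≢vi → contradiction refl vi≢vi }

head-tail-injective : {u v : Vec Bool (suc d)} →
  head u ≡ head v → tail u ≡ tail v → u ≡ v
head-tail-injective {u = _ ∷ _} {_ ∷ _} = cong₂ _∷_

module _ (d : ℕ) where
  open Graph (Q (suc d))

  -- A subset is a vector of Booleans, so the first coordinate itself serves as the characteristic
  -- function.
  facet : VertexSet (Q (suc d))
  facet = tabulate (head ∘ vertex)

  ∈-facet⁺ : ∀ v → head v ≡ true → index v Subset.∈ facet
  ∈-facet⁺ v hv =
    ∈-tabulate⁺ (head ∘ vertex) (trans (cong head (vertex-index (Q (suc d)) v)) hv)

  ∈-facet⁻ : ∀ v → index v Subset.∈ facet → head v ≡ true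
  ∈-facet⁻ v v∈ =
    trans (cong head (sym (vertex-index (Q (suc d)) v))) (∈-tabulate⁻ (head ∘ vertex) v∈)

  vertex-injective : ∀ {i j} → vertex i ≡ vertex j → i ≡ j
  vertex-injective {i} {j} eq =
    trans (sym (index-vertex (Q (suc d)) i))
          (trans (cong index eq) (index-vertex (Q (suc d)) j))

  facet-dominating : IsDominating (Q (suc d)) facet
  facet-dominating (true  ∷ v) v∉ = contradiction (∈-facet⁺ (true ∷ v) refl) v∉
  facet-dominating (false ∷ v) _  = true ∷ v , heads-differ v (λ ()) , ∈-facet⁺ (true ∷ v) refl

  -- A neighbor of `u` outside the facet has head `false` while `u` has head `true`, so it shares
  -- the tail of `u`; head and tail together determine it.
  facet-limited : ∀ u → index u Subset.∈ facet → ∣ N (Q (suc d)) u ─ facet ∣ ≤ 1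
  facet-limited u u∈ = unique⇒∣p∣≤1 _ λ i∈ j∈ → vertex-injective
    (head-tail-injective (trans (head-false i∈) (sym (head-false j∈)))
                         (trans (sym (same-tail i∈)) (same-tail j∈)))
    where
    head-false : ∀ {i} → i Subset.∈ N (Q (suc d)) u ─ facet → head (vertex i) ≡ false
    head-false i∈ = Bool.¬-not
      (x∈p─q⇒x∉q (N (Q (suc d)) u) facet i∈ ∘ ∈-tabulate⁺ (head ∘ vertex))

    same-tail : ∀ {i} → i Subset.∈ N (Q (suc d)) u ─ facet → tail u ≡ tail (vertex i)
    same-tail {i} i∈ = heads-differ⇒tails≡ u (vertex i)
      (λ eq → contradiction (trans (sym (∈-facet⁻ u u∈)) (trans eq (head-false i∈))) λ ())
      (∈-N⁻ (Q (suc d)) u (p─q⊆p (N (Q (suc d)) u) facet i∈))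

  -- Deleting the first coordinate, which is constant on the facet, maps it injectively into the
  -- vertices of `Q d`.
  ∣facet∣≤2^d : ∣ facet ∣ ≤ 2 ^ d
  ∣facet∣≤2^d = subst (∣ facet ∣ ≤_) (∣⊤∣≡n (2 ^ d))
    (∣∣-mono-injective (λ i j → tail (vertex i) ≡ Graph.vertex (Q d) j) facet ⊤
      (λ {i} _ → Graph.index (Q d) (tail (vertex i)) , ∈⊤ ,
                 sym (vertex-index (Q d) (tail (vertex i))))
      (λ i∈ i′∈ eq eq′ → vertex-injective
        (head-tail-injective
          (trans (∈-tabulate⁻ (head ∘ vertex) i∈) (sym (∈-tabulate⁻ (head ∘ vertex) i′∈)))
          (trans eq (sym eq′)))))

proposition21 : (d : ℕ) → 1 ≤ d → γ₁ᴸ (Q d) ≡ 2 ^ (d ∸ 1)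
proposition21 (suc d) _ with γ₁ᴸ-minimum (Q (suc d))
... | γ , (D , limited , refl) , least = ℕ.≤-antisym
  (ℕ.≤-trans (least _ (facet d , (facet-dominating d , facet-limited d) , refl)) (∣facet∣≤2^d d))
  -- The order of `Q (suc d)` is `2 * 2 ^ d` by definition, and `2 * ∣ D ∣` unfolds to
  -- `∣ D ∣ + (∣ D ∣ + 0)`, so the counting bound is rewritten to that form before the factor 2
  -- cancels.
  (ℕ.*-cancelˡ-≤ 2 (subst (2 * 2 ^ d ≤_) (cong (∣ D ∣ +_) (sym (ℕ.+-identityʳ ∣ D ∣)))
    (order≤∣D∣+∣D∣ (Q (suc d)) D limited)))
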